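{- Any $\mathrm{Res}^*(d)$ refutation of $d\text{ - }\mathrm{RIP}_n$ is of size $2^{\Omega(n/d)}$; that is, there are absolute constants $c>0$ and $n_0$ such that for all $n\ge n_0$ and all integers $d$ with $1\le d\le n$, every $\mathrm{Res}^*(d)$ refutation of $d\text{ - }\mathrm{RIP}_n$ has size at least $2^{cn/d}$.
   Context: Notation: $[n]=\{1,\dots,n\}$. A literal is a propositional variable or its negation. A $d$-conjunction is a conjunction of at most $d$ literals; a $d$-DNF is a disjunction of arbitrarily many $d$-conjunctions. A clause is a disjunction of literals (so it is a $d$-DNF for every $d\ge 1$). The system $\mathrm{Res}(d)$ ($d\ge1$). Lines are $d$-DNFs. Rules ($\mathcal P,\mathcal Q$ are $d$-DNFs, the $\ell_i$ are literals, and all conjunctions have at most $d$ literals): ($\wedge$-introduction) from $\mathcal P\vee\bigwedge_{i\in I_1}\ell_i$ and $\mathcal Q\vee\bigwedge_{i\in I_2}\ell_i$ derive $\mathcal P\vee\mathcal Q\vee\bigwedge_{i\in I_1\cup I_2}\ell_i$, provided $|I_1\cup I_2|\le d$; (cut) from $\mathcal P\vee\bigvee_{i\in I}\ell_i$ and $\mathcal Q\vee\bigwedge_{i\in I}\neg\ell_i$ derive $\mathcal P\vee\mathcal Q$; (weakening 1) from $\mathcal P$ derive $\mathcal P\vee\bigwedge_{i\in I}\ell_i$, provided $|I|\le d$; (weakening 2) from $\mathcal P\vee\bigwedge_{i\in I_1\cup I_2}\ell_i$ derive $\mathcal P\vee\bigwedge_{i\in I_1}\ell_i$. A $\mathrm{Res}(d)$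 refutation of a set of clauses is a derivation of the empty clause from these clauses (axioms), viewed as a directed acyclic graph whose sources are axioms and whose only sink is the empty clause. Its size is the number of internal nodes, i.e. the number of rule applications. $\mathrm{Res}^*(d)$ is the tree-like version: the graph is required to be a tree (each derived line is used at most once as a premise; axioms may be repeated at different leaves). The contradiction $d\text{ - }\mathrm{RIP}_n$ ($d$-relativized Induction principle). Variables: $P_i$ for $i\in[n]$, $R^p_i$ for $i\in[n]$, $p\in[d]$, and $S_{i,j}$ for $1\le i<j\le n$. Write $\neg\mathcal R_i$ for $\bigvee_{p\in[d]}\neg R^p_i$. The clauses are: $P_1$ and $\neg P_n$; $R^p_1$ and $R^p_n$ for $p\in[d]$; $\bigvee_{j=i+1}^{n}S_{i,j}$ for $i\in[n-1]$; $\neg S_{i,j}\vee\neg\mathcal R_i\vee R^p_j$ for $i,j\in[n]$, $i<j$, $p\in[d]$; $\neg S_{i,j}\vee\neg\mathcal R_i\vee\neg P_i\vee P_j$ for $i,j\in[n]$, $i<j$. -}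

module Defs where

open import Data.Fin.Base as Fin using (Fin; toℕ)
open import Data.Fin.Properties using (_<?_)
open import Data.Integer.Base using (+_; -[1+_])
open import Data.List.Base
  using (List; []; _∷_; [_]; _++_; map; mapMaybe; length; allFin)
open import Data.List.Properties using (length-map)
open import Data.List.Relation.Binary.BagAndSetEquality
  using (_∼[_]_; set; [_]-Equality)
import Data.List.Relation.Binary.Subset.Setoid as SetoidSubset
open import Data.Maybe.Base as Maybe using ()
open import Data.Nat.Base
  using (ℕ; suc; _+_; _*_; _^_; _≤_; _<_; NonZero; >-nonZero⁻¹)
open import Data.Product.Base using (_×_)
open import Data.Rational.Base using (ℚ; ↥_; ↧ₙ_)
open import Relation.Binary.Bundles using (Setoid)
import Relation.Binary.Construct.On as On
open import Relation.Binary.PropositionalEquality.Core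
  using (_≡_; sym; subst)
open import Relation.Nullary.Decidable.Core using (dec⇒maybe)

data Literal (V : Set) : Set where
  pos neg : V → Literal V

∁ : ∀ {V} → Literal V → Literal V
∁ (pos x) = neg x
∁ (neg x) = pos x

Clause : Set → Set
Clause V = List (Literal V)

-- A d-conjunction is a set of at most d literals.  The list may repeat
-- literals, but every set of at most d literals has a list of length at
-- most d, and conjunctions are only ever compared as sets (see _≈_).
record Conj (V : Set) (d : ℕ) : Set where
  constructor ⋀
  field
    lits  : List (Literal V)
    bound : length lits ≤ d

open Conj public

⋀∁ : ∀ {V d} → Conj V d → Conj V d
⋀∁ {d = d} I =
  ⋀ (map ∁ (lits I)) (subst (_≤ d) (sym (length-map ∁ (lits I))) (bound I))

conjSetoid : Set → ℕ → Setoid _ _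
conjSetoid V d = On.setoid ([ set ]-Equality (Literal V)) (lits {V} {d})

DNF : Set → ℕ → Set
DNF V d = List (Conj V d)

-- Equality of DNFs as sets of sets of literals.
infix 4 _≈_
_≈_ : ∀ {V d} → DNF V d → DNF V d → Set
_≈_ {V} {d} A B = A ⊆ B × B ⊆ A
  where open SetoidSubset (conjSetoid V d) using (_⊆_)

module _ {V : Set} {d : ℕ} .{{_ : NonZero d}} where

  unit : Literal V → Conj V d
  unit ℓ = ⋀ [ ℓ ] (>-nonZero⁻¹ d)

  ⋁ : Clause V → DNF V d
  ⋁ = map unit

  -- Tree-like Res(d) derivations from the set of clauses Ax.
  -- Lines are sets of conjunctions: conv only changes the list that
  -- represents a line, so it is not a rule and does not count in size.
  infix 3 _⊢_
  data _⊢_ (Ax : Clause V → Set) : DNF V d → Set where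
    axiom : ∀ {C} → Ax C → Ax ⊢ ⋁ C
    conv  : ∀ {A B} → A ≈ B → Ax ⊢ A → Ax ⊢ B
    ∧-intro : ∀ {P Q} {I₁ I₂ J : Conj V d} →
      lits J ∼[ set ] lits I₁ ++ lits I₂ →
      Ax ⊢ I₁ ∷ P → Ax ⊢ I₂ ∷ Q → Ax ⊢ J ∷ (P ++ Q)
    cut : ∀ {P Q} (I : Conj V d) →
      Ax ⊢ ⋁ (lits I) ++ P → Ax ⊢ ⋀∁ I ∷ Q → Ax ⊢ P ++ Q
    weakening₁ : ∀ {P} (I : Conj V d) →
      Ax ⊢ P → Ax ⊢ I ∷ P
    weakening₂ : ∀ {P} {I₁ I₂ J : Conj V d} →
      lits J ∼[ set ] lits I₁ ++ lits I₂ →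
      Ax ⊢ J ∷ P → Ax ⊢ I₁ ∷ P

  size : ∀ {Ax A} → Ax ⊢ A → ℕ
  size (axiom _)         = 0
  size (conv _ π)        = size π
  size (∧-intro _ π₁ π₂) = suc (size π₁ + size π₂)
  size (cut _ π₁ π₂)     = suc (size π₁ + size π₂)
  size (weakening₁ _ π)  = suc (size π)
  size (weakening₂ _ π)  = suc (size π)

Refutation : ∀ {V} (d : ℕ) .{{_ : NonZero d}} → (Clause V → Set) → Set
Refutation d Ax = _⊢_ {d = d} Ax []

-- The index i ∈ {1,…,n} is the element i ∸ 1 of Fin n.  The proof in S is
-- irrelevant, so there is one variable S i j for each pair i < j.
data Var (d n : ℕ) : Set where
  P : Fin n → Var d n
  R : Fin d → Fin n → Var d n
  S : (i j : Fin n) → .(i Fin.< j) → Var d n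

module _ {d n : ℕ} where

  ¬ℛ : Fin n → Clause (Var d n)
  ¬ℛ i = map (λ p → neg (R p i)) (allFin d)

  successors : Fin n → Clause (Var d n)
  successors i =
    mapMaybe (λ j → Maybe.map (λ i<j → pos (S i j i<j)) (dec⇒maybe (i <? j)))
             (allFin n)

IsFirst IsLast : ∀ {n} → Fin n → Set
IsFirst i = toℕ i ≡ 0
IsLast {n} i = suc (toℕ i) ≡ n

data RIP (d n : ℕ) : Clause (Var d n) → Set where
  P-first : ∀ {i} → IsFirst i → RIP d n [ pos (P i) ]
  P-last  : ∀ {i} → IsLast i → RIP d n [ neg (P i) ]
  R-first : ∀ {i} p → IsFirst i → RIP d n [ pos (R p i) ]
  R-last  : ∀ {i} p → IsLast i → RIP d n [ pos (R p i) ]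
  S-some  : ∀ i → suc (toℕ i) < n → RIP d n (successors i)
  R-step  : ∀ {i j} (i<j : i Fin.< j) p →
    RIP d n (neg (S i j i<j) ∷ ¬ℛ i ++ [ pos (R p j) ])
  P-step  : ∀ {i j} (i<j : i Fin.< j) →
    RIP d n (neg (S i j i<j) ∷ ¬ℛ i ++ neg (P i) ∷ [ pos (P j) ])

-- 2^ q ≤ s is the inequality 2^q ≤ s of real numbers, for rational q = a/b
-- with b > 0: it is equivalent to 2^a ≤ s^b.
infix 4 2^_≤_
2^_≤_ : ℚ → ℕ → Set
2^ q ≤ s with ↥ q
... | + a      = 2 ^ a ≤ s ^ ↧ₙ q
... | -[1+ a ] = 1 ≤ 2 ^ suc a * s ^ ↧ₙ q

{-# OPTIONS --safe #-}
module Submission where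

-- Delayer's strategy, run directly on the derivation.  A state is a set of
-- valuations that all falsify the current line.  If the conjunction used by an
-- ∧-introduction or a cut takes both values on the state, then each value can be
-- forced on a smaller state by fixing O(d) further rows (the row i consists of
-- the variables with first index i), so both subderivations are large.
--
-- In a state all rows are fixed but those of a source x in P ∩ R and of a list L
-- of live indices above x.  From x a chain of 2d + 1 rows in P ∩ R, each linked
-- by S to the next one only, runs through L; it never has skipped more live
-- indices than it has taken.  Given at most d literals that hold in a valuation of
-- the state, mark their rows.  By a ballot argument some unmarked row of the
-- chain allows it to continue by taking all unmarked indices and skipping all
-- marked ones, so its end is unmarked and becomes the new source.  The rows off the
-- chain are moved out of P ∩ R, which respects the literals because forcing a row
-- into P ∩ R takes d + 1 of them.

open import Defs
open import Data.Bool.Base using (Bool; true; false; not; if_then_else_)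
open import Data.Bool.Properties using () renaming (_≟_ to _≟ᵇ_)
open import Data.Empty using (⊥; ⊥-elim)
open import Data.Fin.Base as Fin using (Fin; toℕ; fromℕ; fromℕ<)
import Data.Fin.Properties as Fin
import Data.Integer.Base as ℤ
import Data.Integer.Properties as ℤ
open import Data.List.Base as List
  using (List; []; _∷_; [_]; _++_; map; length; lookup; filter; allFin; tabulate)
import Data.List.Membership.DecPropositional as DecMembership
open import Data.List.Membership.Propositional using (_∈_; _∉_; find; lose)
open import Data.List.Membership.Propositional.Properties
  using (∈-++⁺ˡ; ∈-lookup; ∈-map⁺; ∈-filter⁻; ∈-tabulate⁻; ∈-allFin)
import Data.List.Membership.Setoid as SetoidMembership
open import Data.List.Membership.Setoid.Properties using (index-injective)
open import Data.List.Properties using (length-map; length-tabulate; length-++)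
open import Data.List.Relation.Binary.BagAndSetEquality using (_∼[_]_; set)
open import Data.List.Relation.Binary.Sublist.Propositional as Sublist
  using (_⊆_; []; _∷_; _∷ʳ_; ⊆-refl; ⊆-trans)
import Data.List.Relation.Binary.Sublist.Propositional.Properties as Sublist
open import Data.List.Relation.Unary.All as All using (All; []; _∷_)
import Data.List.Relation.Unary.All.Properties as All
open import Data.List.Relation.Unary.AllPairs as AllPairs using (AllPairs; []; _∷_)
import Data.List.Relation.Unary.AllPairs.Properties as AllPairs
open import Data.List.Relation.Unary.Any as Any using (Any; here; there; index)
import Data.List.Relation.Unary.Any.Properties as Any
open import Data.List.Relation.Unary.Unique.Propositional using (Unique)
open import Data.Maybe.Base as Maybe using ()
import Data.Maybe.Relation.Unary.Any as MaybeAny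
open import Data.Nat.Base
open import Data.Nat.DivMod using (m/n*n≤m; m≡m%n+[m/n]*n; m%n<n)
open import Data.Nat.Properties
open import Data.Nat.Tactic.RingSolver using (solve-∀)
open import Data.Product.Base using (∃; ∃₂; ∃-syntax; _×_; _,_; proj₁; proj₂)
open import Data.Rational.Base as ℚ using (ℚ; 0ℚ)
import Data.Rational.Properties as ℚ
open import Data.Rational.Unnormalised.Base as ℚᵘ using (mkℚᵘ; *≤*)
import Data.Rational.Unnormalised.Properties as ℚᵘ
open import Data.Sum.Base using (inj₁; inj₂)
open import Function.Base using (_∘_; case_of_)
open import Function.Bundles using (Equivalence)
open import Relation.Binary.Bundles using (Setoid)
open import Relation.Binary.Definitions using (DecidableEquality)
open import Relation.Binary.PropositionalEquality
  using (_≡_; _≢_; refl; sym; trans; cong; subst; subst₂; setoid)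
open import Relation.Nullary using (¬_; Dec; yes; no; contradiction; ¬?; does)
open import Relation.Nullary.Decidable
  using (decidable-stable; dec-true; dec-false; dec⇒maybe; from-yes; map′; _×-dec_)
open import Relation.Unary using (Decidable)

-- Semantics and the size of tree-like Res(d) refutations

module Semantics {V X : Set} (value : X → V → Bool) where

  infix 4 _⊨_ _⊨∧_ _⊨∨_ _⊨DNF_
  _⊨_ : X → Literal V → Set
  α ⊨ pos v = value α v ≡ true
  α ⊨ neg v = value α v ≡ false

  _⊨∧_ _⊨∨_ : X → List (Literal V) → Set
  α ⊨∧ ℓs = All (α ⊨_) ℓs
  α ⊨∨ ℓs = Any (α ⊨_) ℓs

  _⊨DNF_ : ∀ {d} → X → DNF V d → Set
  α ⊨DNF A = Any (λ I → α ⊨∧ lits I) A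

  _⊨?_ : ∀ α → Decidable (α ⊨_)
  α ⊨? pos v = value α v ≟ᵇ true
  α ⊨? neg v = value α v ≟ᵇ false

  consistent : ∀ {α} v → α ⊨ pos v → ¬ α ⊨ neg v
  consistent v t f = case trans (sym t) f of λ ()

  ∁-sound : ∀ {α} ℓ → α ⊨ ∁ ℓ → ¬ α ⊨ ℓ
  ∁-sound (pos v) f t = consistent v t f
  ∁-sound (neg v) t f = consistent v t f

  ∁-complete : ∀ {α} ℓ → ¬ α ⊨ ℓ → α ⊨ ∁ ℓ
  ∁-complete {α} (pos v) h with value α v
  ... | true  = contradiction refl h
  ... | false = refl
  ∁-complete {α} (neg v) h with value α v
  ... | true  = refl
  ... | false = contradiction refl h

  ⊨∧-resp : ∀ {α} I J → J ∼[ set ] I → α ⊨∧ I → α ⊨∧ J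
  ⊨∧-resp I J J∼I h = All.tabulate λ ℓ∈J → All.lookup h (Equivalence.to J∼I ℓ∈J)

  ⊨DNF-resp : ∀ {d α} (A B : DNF V d) → A ≈ B → α ⊨DNF A → α ⊨DNF B
  ⊨DNF-resp {d} {α} A B (A⊆B , _) h =
    let I , I∈A , hI = find h
    in ∈ˢ.lose {P = λ J → α ⊨∧ lits J} (λ {I} {J} → resp {I} {J}) {I} (A⊆B {I} (raise I∈A)) hI
    where
    module ∈ˢ = SetoidMembership (conjSetoid V d)
    module ≈ˢ = Setoid (conjSetoid V d)
    raise : ∀ {I A} → I ∈ A → I ∈ˢ.∈ A
    raise {I} (here refl)  = here λ {z} → ≈ˢ.refl {I} {z}
    raise {I} (there I∈A) = there (raise I∈A)
    resp : ∀ {I J} → I ≈ˢ.≈ J → α ⊨∧ lits I → α ⊨∧ lits J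
    resp {I} {J} I∼J = ⊨∧-resp (lits I) (lits J) (≈ˢ.sym {I} {J} I∼J)

  module _ {d : ℕ} .{{_ : NonZero d}} where

    ⊨-⋁⁺ : ∀ {α} {C : Clause V} → α ⊨∨ C → α ⊨DNF (⋁ {d = d} C)
    ⊨-⋁⁺ = Any.map⁺ ∘ Any.map (_∷ [])

    ⊨-⋁⁻ : ∀ {α} {C : Clause V} → α ⊨DNF (⋁ {d = d} C) → α ⊨∨ C
    ⊨-⋁⁻ = Any.map (λ where (h ∷ []) → h) ∘ Any.map⁻

    ⊨-∧-introʳ : ∀ {α Ψ} {Φ : DNF V d} (I₁ I₂ J : Conj V d) →
      lits J ∼[ set ] lits I₁ ++ lits I₂ → α ⊨∧ lits I₁ →
      α ⊨DNF I₂ ∷ Ψ → α ⊨DNF J ∷ (Φ ++ Ψ)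
    ⊨-∧-introʳ I₁ I₂ J J∼ h₁ (here h₂) =
      here (⊨∧-resp (lits I₁ ++ lits I₂) (lits J) J∼ (All.++⁺ h₁ h₂))
    ⊨-∧-introʳ {Φ = Φ} _ _ _ J∼ h₁ (there q) = there (Any.++⁺ʳ Φ q)

    ⊨-cutˡ : ∀ {α Φ Ψ} (I : Conj V d) → α ⊨∧ lits (⋀∁ I) →
      α ⊨DNF ⋁ (lits I) ++ Φ → α ⊨DNF Φ ++ Ψ
    ⊨-cutˡ I hI h with Any.++⁻ (⋁ (lits I)) h
    ... | inj₂ p = Any.++⁺ˡ p
    ... | inj₁ i with find (⊨-⋁⁻ {C = lits I} i)
    ...   | ℓ , ℓ∈I , t = contradiction t (∁-sound ℓ (All.lookup (All.map⁻ hI) ℓ∈I))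

    ⊨-weakening₂ : ∀ {α} {Φ : DNF V d} (I₁ I₂ J : Conj V d) →
      lits J ∼[ set ] lits I₁ ++ lits I₂ → α ⊨DNF J ∷ Φ → α ⊨DNF I₁ ∷ Φ
    ⊨-weakening₂ I₁ I₂ J J∼ (here h)  =
      here (All.tabulate λ ℓ∈I → All.lookup h (Equivalence.from J∼ (∈-++⁺ˡ ℓ∈I)))
    ⊨-weakening₂ I₁ I₂ J J∼ (there p) = there p

module _ {V : Set} {d : ℕ} .{{_ : NonZero d}} {Ax : Clause V → Set} where

  leaves : ∀ {A : DNF V d} → Ax ⊢ A → List (∃ Ax)
  leaves (axiom a)         = [ _ , a ]
  leaves (conv _ π)        = leaves π
  leaves (∧-intro _ π₁ π₂) = leaves π₁ ++ leaves π₂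
  leaves (cut _ π₁ π₂)     = leaves π₁ ++ leaves π₂
  leaves (weakening₁ _ π)  = leaves π
  leaves (weakening₂ _ π)  = leaves π

  length-leaves : ∀ {A : DNF V d} (π : Ax ⊢ A) → length (leaves π) ≤ suc (size π)
  length-leaves-++ : ∀ {A B : DNF V d} (π₁ : Ax ⊢ A) (π₂ : Ax ⊢ B) →
    length (leaves π₁ ++ leaves π₂) ≤ suc (suc (size π₁ + size π₂))

  length-leaves (axiom _)         = ≤-refl
  length-leaves (conv _ π)        = length-leaves π
  length-leaves (∧-intro _ π₁ π₂) = length-leaves-++ π₁ π₂
  length-leaves (cut _ π₁ π₂)     = length-leaves-++ π₁ π₂
  length-leaves (weakening₁ _ π)  = m≤n⇒m≤1+n (length-leaves π)
  length-leaves (weakening₂ _ π)  = m≤n⇒m≤1+n (length-leaves π)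

  length-leaves-++ π₁ π₂ = begin
    length (leaves π₁ ++ leaves π₂)         ≡⟨ length-++ (leaves π₁) ⟩
    length (leaves π₁) + length (leaves π₂) ≤⟨ +-mono-≤ (length-leaves π₁) (length-leaves π₂) ⟩
    suc (size π₁ + suc (size π₂))           ≡⟨ cong suc (+-suc _ _) ⟩
    suc (suc (size π₁ + size π₂))           ∎
    where open ≤-Reasoning

  module _ {X : Set} (value : X → V → Bool) where
    open Semantics value

    -- Soundness read backwards: a falsified conclusion has a falsified premise. At a binary rule
    -- the truth value of the conjunction tells which one.
    falsified-leaf : ∀ {A : DNF V d} {α} (π : Ax ⊢ A) → ¬ α ⊨DNF A →
      Any (λ (C , _) → ¬ α ⊨∨ C) (leaves π)
    falsified-leaf (axiom _) h = here (h ∘ ⊨-⋁⁺)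
    falsified-leaf (conv {A} {B} A≈B π) h = falsified-leaf π (h ∘ ⊨DNF-resp A B A≈B)
    falsified-leaf {α = α} (∧-intro {Φ} {I₁ = I₁} {I₂} {J} J∼ π₁ π₂) h
      with All.all? (α ⊨?_) (lits I₁)
    ... | yes h₁ = Any.++⁺ʳ (leaves π₁) (falsified-leaf π₂ (h ∘ ⊨-∧-introʳ {Φ = Φ} I₁ I₂ J J∼ h₁))
    ... | no ¬h₁ = Any.++⁺ˡ (falsified-leaf π₁ λ where
      (here h₁) → ¬h₁ h₁
      (there p) → h (there (Any.++⁺ˡ p)))
    falsified-leaf {α = α} (cut {Φ} I π₁ π₂) h with All.all? (α ⊨?_) (lits (⋀∁ I))
    ... | yes hI = Any.++⁺ˡ (falsified-leaf π₁ (h ∘ ⊨-cutˡ I hI))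
    ... | no ¬hI = Any.++⁺ʳ (leaves π₁) (falsified-leaf π₂ λ where
      (here hI) → ¬hI hI
      (there q) → h (Any.++⁺ʳ Φ q))
    falsified-leaf (weakening₁ _ π) h = falsified-leaf π (h ∘ there)
    falsified-leaf (weakening₂ {I₁ = I₁} {I₂} {J} J∼ π) h =
      falsified-leaf π (h ∘ ⊨-weakening₂ I₁ I₂ J J∼)

    -- No axiom is falsified by two of the `α s`, so sending `s` to a leaf falsified by `α s` is
    -- injective.
    leaves-≥ : ∀ {k} (α : Fin k → X) →
      (∀ {C} → Ax C → ∀ {s t} → ¬ α s ⊨∨ C → ¬ α t ⊨∨ C → s ≡ t) →
      (π : Refutation d Ax) → k ≤ suc (size π)
    leaves-≥ {k} α separated π = ≤-trans (Fin.injective⇒≤ {f = at} at-injective) (length-leaves π)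
      where
      false-at : ∀ s → Any (λ (C , _) → ¬ α s ⊨∨ C) (leaves π)
      false-at s = falsified-leaf π λ ()
      at : Fin k → Fin (length (leaves π))
      at s = index (false-at s)
      at-injective : ∀ {s t} → at s ≡ at t → s ≡ t
      at-injective {s} {t} eq = separated (proj₂ (lookup (leaves π) (at s)))
        (Any.lookup-index (false-at s))
        (subst (λ i → ¬ α t ⊨∨ proj₁ (lookup (leaves π) i)) (sym eq)
          (Any.lookup-index (false-at t)))

    -- A Delayer strategy: in a state with k coins left, any value taken by a
    -- set of at most d literals on some valuation of the state can be forced by
    -- spending one coin.
    record Strategy : Set₁ where
      infix 4 _∈ˢ_
      field
        State     : ℕ → Set
        _∈ˢ_      : ∀ {k} → X → State k → Set
        unrefuted : ∀ {k C} (σ : State (suc k)) → Ax C →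
          ¬ (∀ {α} → α ∈ˢ σ → ¬ α ⊨∨ C)
        force     : ∀ {k α} (σ : State (suc k)) → α ∈ˢ σ →
          ∀ T → length T ≤ d → α ⊨∧ T →
          ∃ λ (τ : State k) → ∀ {β} → β ∈ˢ τ → β ∈ˢ σ × β ⊨∧ T

    module _ (strategy : Strategy) where
      open Strategy strategy

      -- `B` stands for the truth of a line and `s` for the size of its derivation, so that `branch`
      -- serves both binary rules.
      Forces : (X → Set) → ℕ → Set
      Forces B s = ∀ {k} (σ : State k) → (∀ {α} → α ∈ˢ σ → ¬ B α) → 2 ^ k ≤ suc s

      -- If I takes both values on σ, a coin is spent on either answer and both
      -- premises are large; otherwise one premise is falsified on all of σ.
      branch : ∀ {B₁ B₀ s₁ s₀ k} (σ : State k) I → length I ≤ d →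
        Forces B₁ s₁ → Forces B₀ s₀ →
        (∀ {α} → α ∈ˢ σ → α ⊨∧ I → ¬ B₁ α) →
        (∀ {α} → α ∈ˢ σ → ¬ α ⊨∧ I → ¬ B₀ α) →
        2 ^ k ≤ suc (suc (s₁ + s₀))
      branch {k = zero} _ _ _ _ _ _ _ = s≤s z≤n
      branch {B₁} {B₀} {s₁} {s₀} {suc k} σ I I≤d F₁ F₀ h₁ h₀ =
        -- A state offers no search for valuations giving `I` either value, so the decidable
        -- conclusion is proved by contradiction: if neither premise is falsified throughout `σ`,
        -- valuations of both kinds exist and `both` applies.
        decidable-stable (2 ^ suc k ≤? _) λ small →
          small (≤-trans (F₀ σ λ α∈σ b₀ → h₀ α∈σ (λ α⊨I →
            small (≤-trans (F₁ σ λ {β} β∈σ b₁ → case All.all? (β ⊨?_) I of λ where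
              (yes β⊨I) → h₁ β∈σ β⊨I b₁
              (no  β⊭I) → small (both α∈σ α⊨I β∈σ β⊭I))
              (s≤s (m≤n⇒m≤1+n (m≤m+n s₁ s₀))))) b₀)
            (s≤s (m≤n⇒m≤1+n (m≤n+m s₀ s₁))))
        where
        half₁ : ∀ {α} → α ∈ˢ σ → α ⊨∧ I → 2 ^ k ≤ suc s₁
        half₁ α∈σ α⊨I with force σ α∈σ I I≤d α⊨I
        ... | τ , τ⊨I = F₁ τ λ β∈τ → h₁ (proj₁ (τ⊨I β∈τ)) (proj₂ (τ⊨I β∈τ))

        half₀ : ∀ {α} → α ∈ˢ σ → ¬ α ⊨∧ I → 2 ^ k ≤ suc s₀
        -- One false literal keeps `I` false, so only its complement is forced.
        half₀ {α} α∈σ α⊭I with find (All.¬All⇒Any¬ (α ⊨?_) I α⊭I)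
        ... | ℓ , ℓ∈I , α⊭ℓ
          with force σ α∈σ [ ∁ ℓ ] (>-nonZero⁻¹ d) (∁-complete ℓ α⊭ℓ ∷ [])
        ...   | τ , τ⊨∁ℓ = F₀ τ λ β∈τ → h₀ (proj₁ (τ⊨∁ℓ β∈τ)) λ β⊨I →
          ∁-sound ℓ (All.head (proj₂ (τ⊨∁ℓ β∈τ))) (All.lookup β⊨I ℓ∈I)

        both : ∀ {α β} → α ∈ˢ σ → α ⊨∧ I → β ∈ˢ σ → ¬ β ⊨∧ I →
          2 ^ suc k ≤ suc (suc (s₁ + s₀))
        both α∈σ α⊨I β∈σ β⊭I = begin
          2 ^ k + (2 ^ k + 0) ≡⟨ cong (_+_ (2 ^ k)) (+-identityʳ _) ⟩
          2 ^ k + 2 ^ k       ≤⟨ +-mono-≤ (half₁ α∈σ α⊨I) (half₀ β∈σ β⊭I) ⟩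
          suc (s₁ + suc s₀)   ≡⟨ cong suc (+-suc _ _) ⟩
          suc (suc (s₁ + s₀)) ∎
          where open ≤-Reasoning

      size-lower-bound : ∀ {A : DNF V d} (π : Ax ⊢ A) → Forces (_⊨DNF A) (size π)
      size-lower-bound _ {zero} _ _ = s≤s z≤n
      size-lower-bound (axiom a) {suc k} σ h =
        ⊥-elim (unrefuted σ a λ α∈σ → h α∈σ ∘ ⊨-⋁⁺)
      size-lower-bound (conv {A} {B} A≈B π) σ h =
        size-lower-bound π σ λ α∈σ → h α∈σ ∘ ⊨DNF-resp A B A≈B
      size-lower-bound (∧-intro {Φ} {I₁ = I₁} {I₂} {J} J∼ π₁ π₂) σ h =
        -- Where `I₁` holds the second premise is falsified, elsewhere the first; hence the reversed
        -- order, undone by `+-comm`.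
        ≤-trans (branch σ (lits I₁) (bound I₁) (size-lower-bound π₂) (size-lower-bound π₁)
          (λ α∈σ h₁ → h α∈σ ∘ ⊨-∧-introʳ {Φ = Φ} I₁ I₂ J J∼ h₁)
          (λ where
            α∈σ ¬h₁ (here h₁) → ¬h₁ h₁
            α∈σ ¬h₁ (there p) → h α∈σ (there (Any.++⁺ˡ p))))
          (≤-reflexive (cong (suc ∘ suc) (+-comm (size π₂) (size π₁))))
      size-lower-bound (cut {Φ} I π₁ π₂) σ h =
        branch σ (lits (⋀∁ I)) (bound (⋀∁ I)) (size-lower-bound π₁) (size-lower-bound π₂)
          (λ α∈σ hI → h α∈σ ∘ ⊨-cutˡ I hI)
          (λ where
            α∈σ ¬hI (here hI) → ¬hI hI
            α∈σ ¬hI (there q) → h α∈σ (Any.++⁺ʳ Φ q))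
      size-lower-bound (weakening₁ _ π) σ h =
        m≤n⇒m≤1+n (size-lower-bound π σ λ α∈σ → h α∈σ ∘ there)
      size-lower-bound (weakening₂ {I₁ = I₁} {I₂} {J} J∼ π) σ h =
        m≤n⇒m≤1+n (size-lower-bound π σ λ α∈σ → h α∈σ ∘ ⊨-weakening₂ I₁ I₂ J J∼)

-- Lists and ballot sequences

length-filter-¬ : ∀ {A : Set} {Q : A → Set} (Q? : Decidable Q) xs →
  length xs ≡ length (filter Q? xs) + length (filter (¬? ∘ Q?) xs)
length-filter-¬ Q? []       = refl
length-filter-¬ Q? (x ∷ xs) with Q? x
... | yes _ = cong suc (length-filter-¬ Q? xs)
... | no _  = trans (cong suc (length-filter-¬ Q? xs)) (sym (+-suc _ _))

AllPairs-resp-⊆ : ∀ {A : Set} {_~_ : A → A → Set} {xs ys : List A} →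
  xs ⊆ ys → AllPairs _~_ ys → AllPairs _~_ xs
AllPairs-resp-⊆ []         _          = []
AllPairs-resp-⊆ (_ ∷ʳ s)   (_ ∷ ps)   = AllPairs-resp-⊆ s ps
AllPairs-resp-⊆ (refl ∷ s) (p ∷ ps)   = Sublist.All-resp-⊆ s p ∷ AllPairs-resp-⊆ s ps

lookup-injective : ∀ {A : Set} {xs : List A} → Unique xs →
  ∀ {i j} → lookup xs i ≡ lookup xs j → i ≡ j
lookup-injective (_ ∷ _) {Fin.zero} {Fin.zero} _ = refl
lookup-injective (x∉ ∷ _) {Fin.zero} {Fin.suc j} eq =
  contradiction eq (All.lookup x∉ (∈-lookup j))
lookup-injective (x∉ ∷ _) {Fin.suc i} {Fin.zero} eq =
  contradiction (sym eq) (All.lookup x∉ (∈-lookup i))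
lookup-injective (_ ∷ u) {Fin.suc i} {Fin.suc j} eq = cong Fin.suc (lookup-injective u eq)

Unique-length-≤ : ∀ {A : Set} {xs ys : List A} → Unique xs →
  (∀ {x} → x ∈ xs → x ∈ ys) → length xs ≤ length ys
Unique-length-≤ {A} {xs} u xs⊆ys = Fin.injective⇒≤ λ {i} {j} eq → lookup-injective u
  (index-injective (setoid A) (xs⊆ys (∈-lookup i)) (xs⊆ys (∈-lookup j)) eq)

-- Ballot s k L ys M: scanning L, k elements ys are taken and M remains; s plus
-- the number of taken elements always dominates the number of skipped ones.
data Ballot {A : Set} : ℕ → ℕ → List A → List A → List A → Set where
  stop : ∀ {s L} → Ballot s 0 L [] L
  take : ∀ {s k l L ys M} → Ballot (suc s) k L ys M → Ballot s (suc k) (l ∷ L) (l ∷ ys) M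
  skip : ∀ {s k l L ys M} → Ballot s k L ys M → Ballot (suc s) k (l ∷ L) ys M

module _ {A : Set} where

  Ballot-⊆ : ∀ {s k} {L ys M : List A} → Ballot s k L ys M → ys ++ M ⊆ L
  Ballot-⊆ stop     = ⊆-refl
  Ballot-⊆ (take b) = refl ∷ Ballot-⊆ b
  Ballot-⊆ (skip b) = _ ∷ʳ Ballot-⊆ b

  -- The slack pays for every skip, so at most `s + k` elements are skipped besides the `k` taken.
  Ballot-length : ∀ {s k} {L ys M : List A} → Ballot s k L ys M →
    length L ≤ s + 2 * k + length M
  Ballot-length {s} {L = L} stop = m≤n+m (length L) (s + 0)
  Ballot-length {s} {suc k} {M = M} (take b) = begin
    suc _                            ≤⟨ s≤s (Ballot-length b) ⟩
    suc (suc s + 2 * k + length M)   ≡⟨ eq s k (length M) ⟩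
    s + 2 * suc k + length M         ∎
    where
    open ≤-Reasoning
    eq : ∀ s k m → suc (suc s + 2 * k + m) ≡ s + 2 * suc k + m
    eq = solve-∀
  Ballot-length (skip b) = s≤s (Ballot-length b)

  prefix-Ballot : ∀ {s} k {L : List A} → k ≤ length L → Ballot s k L (List.take k L) (List.drop k L)
  prefix-Ballot zero k≤ = stop
  prefix-Ballot (suc k) {_ ∷ _} (s≤s k≤) = take (prefix-Ballot k k≤)

  module _ {Marked : A → Set} (marked? : Decidable Marked) where

    marks : List A → ℕ
    marks L = length (filter marked? L)

    -- The least initial slack with which all marked elements can be skipped
    -- while taking all the others.
    debt : List A → ℕ
    debt []      = 0
    debt (l ∷ L) with marked? l
    ... | yes _ = suc (debt L)
    ... | no  _ = pred (debt L)

    debt≤marks : ∀ L → debt L ≤ marks L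
    debt≤marks []      = z≤n
    debt≤marks (l ∷ L) with marked? l
    ... | yes _ = s≤s (debt≤marks L)
    ... | no  _ = ≤-trans pred[n]≤n (debt≤marks L)

    -- Marked elements of `u ∷ ys′` keep the successor they have in `u ∷ ys`: the paths agree up to
    -- an unmarked element, and no mark follows it.
    data Diverges (u : A) : List A → List A → Set where
      follow : ∀ {v ys ys′} → Diverges v ys ys′ → Diverges u (v ∷ ys) (v ∷ ys′)
      depart : ∀ {ys ys′} → ¬ Marked u → All (¬_ ∘ Marked) ys′ → Diverges u ys ys′

    -- Skip exactly the marked elements. `debt L ≤ s` makes the slack sufficient, and the second
    -- bound leaves `k` unmarked elements to take.
    greedy : ∀ {s} k L → debt L ≤ s → k + marks L ≤ length L →
      ∃₂ λ ys M → Ballot s k L ys M × All (¬_ ∘ Marked) ys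
    greedy zero L _ _ = _ , _ , stop , []
    greedy (suc k) [] _ ()
    greedy (suc k) (l ∷ L) d≤s k≤ with marked? l
    greedy {suc s} (suc k) (l ∷ L) (s≤s d≤s) (s≤s k≤) | yes _
      with greedy (suc k) L d≤s (subst (_≤ length L) (+-suc k _) k≤)
    ... | _ , _ , b , us = _ , _ , skip b , us
    greedy {s} (suc k) (l ∷ L) d≤s (s≤s k≤) | no l∉
      with greedy k L (pred[m]≤n⇒m≤1+n d≤s) k≤
      where
      pred[m]≤n⇒m≤1+n : ∀ {m n} → pred m ≤ n → m ≤ suc n
      pred[m]≤n⇒m≤1+n {zero} _ = z≤n
      pred[m]≤n⇒m≤1+n {suc m} p = s≤s p
    ... | _ , _ , b , us = _ , _ , take b , l∉ ∷ us

    private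
      unmarked-eq : ∀ s k m → s + 2 * suc k + m ≡ suc (suc s + 2 * k + m)
      unmarked-eq = solve-∀

      marked-eq : ∀ s k m → s + 2 * suc k + suc m ≡ suc (suc (suc s + 2 * k + m))
      marked-eq = solve-∀

    -- Each unmarked element followed by a positive debt cancels one mark, so
    -- fewer than k taken elements fail to be points of departure.
    diverge : ∀ {s k L ys M} u → Ballot s k L ys M →
      2 * marks L < k + debt L → s + 2 * k + marks L ≤ length L →
      ∃₂ λ ys′ M′ → Ballot s k L ys′ M′ × Diverges u ys ys′
    -- `2 * marks L < k + debt L` is invariant along the path; for `k = 0` it contradicts
    -- `debt L ≤ marks L`.
    diverge {L = L} u stop m< _ = contradiction m< (≤⇒≯ (≤-trans (debt≤marks L) (m≤m+n _ _)))
    diverge {s} {suc k} {l ∷ L} u (take b) m< long with marked? l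
    ... | yes _ =
      let _ , _ , b′ , e = diverge l b
            (+-cancelˡ-< 2 _ _ (subst₂ _<_ (*-suc 2 (marks L)) (cong suc (+-suc k _)) m<))
            (m+n≤o⇒n≤o 1 (s≤s⁻¹ (subst (_≤ suc (length L)) (marked-eq s k (marks L)) long)))
      in _ , _ , take b′ , follow e
    -- Taking `l` raises the slack to `suc s`. If this covers the debt, depart at `l` and go on
    -- greedily; otherwise `debt L` is positive, hence one more than `debt (l ∷ L)`, which offsets
    -- the step used up.
    ... | no l∉ with debt L ≤? suc s
    ...   | yes d≤ =
      let _ , _ , b′ , us = greedy k L d≤ (≤-trans
            (+-monoˡ-≤ (marks L) (≤-trans (m≤m+n k _) (m≤n+m _ (suc s)))) long′)
      in _ , _ , take b′ , follow (depart l∉ us)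
      where
      long′ : suc s + 2 * k + marks L ≤ length L
      long′ = s≤s⁻¹ (subst (_≤ suc (length L)) (unmarked-eq s k (marks L)) long)
    ...   | no  d≰ =
      let _ , _ , b′ , e = diverge l b
            (subst (2 * marks L <_) (trans (sym (+-suc k _)) (cong (k +_) positive)) m<)
            (s≤s⁻¹ (subst (_≤ suc (length L)) (unmarked-eq s k (marks L)) long))
      in _ , _ , take b′ , follow e
      where
      positive : suc (pred (debt L)) ≡ debt L
      positive = suc-pred (debt L) {{>-nonZero (≤-<-trans z≤n (≰⇒> d≰))}}
    diverge {suc s} {k} {l ∷ L} u (skip b) m< long with marked? l
    ... | yes _ =
      let _ , _ , b′ , e = diverge u b
            (m+n≤o⇒n≤o 1 (s≤s⁻¹ (subst₂ _<_ (*-suc 2 (marks L)) (+-suc k _) m<)))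
            (m+n≤o⇒n≤o 1 (subst (_≤ length L) (+-suc (s + 2 * k) (marks L)) (s≤s⁻¹ long)))
      in _ , _ , skip b′ , e
    ... | no l∉ =
      let _ , _ , b′ , e = diverge u b
            (≤-trans m< (+-monoʳ-≤ k pred[n]≤n)) (s≤s⁻¹ long)
      in _ , _ , skip b′ , e

-- Valuations of RIP by rows

infix 4 _≟ᵛ_ _≟ˡ_
_≟ᵛ_ : ∀ {d n} → DecidableEquality (Var d n)
P i ≟ᵛ P j = map′ (cong P) (λ where refl → refl) (i Fin.≟ j)
R p i ≟ᵛ R q j =
  map′ (λ where (refl , refl) → refl) (λ where refl → refl , refl) (p Fin.≟ q ×-dec i Fin.≟ j)
S i j _ ≟ᵛ S k l _ =
  map′ (λ where (refl , refl) → refl) (λ where refl → refl , refl) (i Fin.≟ k ×-dec j Fin.≟ l)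
P _     ≟ᵛ R _ _   = no λ ()
P _     ≟ᵛ S _ _ _ = no λ ()
R _ _   ≟ᵛ P _     = no λ ()
R _ _   ≟ᵛ S _ _ _ = no λ ()
S _ _ _ ≟ᵛ P _     = no λ ()
S _ _ _ ≟ᵛ R _ _   = no λ ()

_≟ˡ_ : ∀ {d n} → DecidableEquality (Literal (Var d n))
pos v ≟ˡ pos w = map′ (cong pos) (λ where refl → refl) (v ≟ᵛ w)
neg v ≟ˡ neg w = map′ (cong neg) (λ where refl → refl) (v ≟ᵛ w)
pos _ ≟ˡ neg _ = no λ ()
neg _ ≟ˡ pos _ = no λ ()

-- The values of all variables with first index i.
record Row (d n : ℕ) (i : Fin n) : Set where
  constructor mkRow
  field
    inP : Bool
    inR : Fin d → Bool
    toS : (j : Fin n) → .(i Fin.< j) → Bool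
open Row

Valuation : ℕ → ℕ → Set
Valuation d n = (i : Fin n) → Row d n i

value : ∀ {d n} → Valuation d n → Var d n → Bool
value α (P i)       = inP (α i)
value α (R p i)     = inR (α i) p
value α (S i j i<j) = toS (α i) j i<j

module _ {d n : ℕ} where
  open Semantics (value {d} {n}) public

  variableRow : Var d n → Fin n
  variableRow (P i)     = i
  variableRow (R _ i)   = i
  variableRow (S i _ _) = i

  literalRow : Literal (Var d n) → Fin n
  literalRow (pos v) = variableRow v
  literalRow (neg v) = variableRow v

  value-cong : ∀ {α β : Valuation d n} v →
    α (variableRow v) ≡ β (variableRow v) → value α v ≡ value β v
  value-cong (P i)       eq = cong inP eq
  value-cong (R p i)     eq = cong (λ r → inR r p) eq
  value-cong (S i j i<j) eq = cong (λ r → toS r j i<j) eq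

  ⊨-cong : ∀ {α β : Valuation d n} ℓ → α (literalRow ℓ) ≡ β (literalRow ℓ) → α ⊨ ℓ → β ⊨ ℓ
  ⊨-cong (pos v) eq t = trans (sym (value-cong v eq)) t
  ⊨-cong (neg v) eq t = trans (sym (value-cong v eq)) t

  ⊨-successors : ∀ {α : Valuation d n} {i j} (i<j : i Fin.< j) →
    toS (α i) j i<j ≡ true → α ⊨∨ successors i
  ⊨-successors {α} {i} {j} i<j t = Any.mapMaybe⁺ _ (allFin n) (Any.map⁺ (lose (∈-allFin j) edge))
    where
    edge : MaybeAny.Any (α ⊨_) (Maybe.map (λ i<j → pos (S i j i<j)) (dec⇒maybe (i Fin.<? j)))
    edge with i Fin.<? j
    ... | yes _   = MaybeAny.just t
    ... | no  i≮j = contradiction i<j i≮j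

  ⊨-¬ℛ : ∀ {α : Valuation d n} {i} p → inR (α i) p ≡ false → α ⊨∨ ¬ℛ i
  ⊨-¬ℛ p f = Any.map⁺ (lose (∈-allFin p) f)

  OnPath : ∀ {i} → Row d n i → Set
  OnPath r = inP r ≡ true × ∀ p → inR r p ≡ true

  link : ∀ {i} → Fin n → Row d n i
  link v = mkRow true (λ _ → true) λ j _ → does (j Fin.≟ v)

  -- The three ways in which a row can satisfy all axioms with source `i`. `outsideP` serves rows
  -- forced into R: they leave P and point only into R.
  data Harmless (α : Valuation d n) (i : Fin n) : Set where
    linked : ∀ {v} → i Fin.< v → α i ≡ link v → OnPath (α v) → Harmless α i
    outsideR : ∀ {v p} (i<v : i Fin.< v) →
      toS (α i) v i<v ≡ true → inR (α i) p ≡ false → Harmless α i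
    outsideP : ∀ {v} (i<v : i Fin.< v) → toS (α i) v i<v ≡ true → inP (α i) ≡ false →
      (∀ {j} (i<j : i Fin.< j) → toS (α i) j i<j ≡ true → ∀ p → inR (α j) p ≡ true) → Harmless α i

  -- Unit axioms get no source, so that `Sound` makes them hold throughout a frame.
  Source : ∀ {C} → RIP d n C → Fin n → Set
  Source (S-some i _)         k = i ≡ k
  Source (R-step {i = i} _ _) k = i ≡ k
  Source (P-step {i = i} _)   k = i ≡ k
  Source _                    _ = ⊥

  source? : ∀ {C} (a : RIP d n C) → Decidable (Source a)
  source? (P-first _) _ = no λ ()
  source? (P-last _) _ = no λ ()
  source? (R-first _ _) _ = no λ ()
  source? (R-last _ _) _ = no λ ()
  source? (S-some i _) k = i Fin.≟ k
  source? (R-step {i = i} _ _) k = i Fin.≟ k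
  source? (P-step {i = i} _) k = i Fin.≟ k

  Source-unique : ∀ {C} (a : RIP d n C) {i j} → Source a i → Source a j → i ≡ j
  Source-unique (S-some _ _) refl refl = refl
  Source-unique (R-step _ _) refl refl = refl
  Source-unique (P-step _)   refl refl = refl

  harmless-sound : ∀ {α : Valuation d n} {i C} → Harmless α i →
    (a : RIP d n C) → Source a i → α ⊨∨ C
  harmless-sound {α} {i} (linked {v} i<v eq _) (S-some _ _) refl =
    ⊨-successors i<v (trans (cong (λ r → toS r v i<v) eq) (dec-true (v Fin.≟ v) refl))
  harmless-sound (outsideR i<v t _) (S-some _ _) refl = ⊨-successors i<v t
  harmless-sound (outsideP i<v t _ _) (S-some _ _) refl = ⊨-successors i<v t
  harmless-sound {α} {i} (linked {v} i<v eq on) (R-step {j = j} i<j p) refl with j Fin.≟ v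
  ... | yes refl = there (Any.++⁺ʳ (¬ℛ i) (here (proj₂ on p)))
  ... | no  j≢v  = here (trans (cong (λ r → toS r j i<j) eq) (dec-false (j Fin.≟ v) j≢v))
  harmless-sound (outsideR {p = p} _ _ f) (R-step _ _) refl = there (Any.++⁺ˡ (⊨-¬ℛ p f))
  harmless-sound {α} {i} (outsideP _ _ _ h) (R-step {j = j} i<j p) refl with toS (α i) j i<j in eq
  ... | true  = there (Any.++⁺ʳ (¬ℛ i) (here (h i<j eq p)))
  ... | false = here eq
  harmless-sound {α} {i} (linked {v} i<v eq on) (P-step {j = j} i<j) refl with j Fin.≟ v
  ... | yes refl = there (Any.++⁺ʳ (¬ℛ i) (there (here (proj₁ on))))
  ... | no  j≢v  = here (trans (cong (λ r → toS r j i<j) eq) (dec-false (j Fin.≟ v) j≢v))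
  harmless-sound (outsideR {p = p} _ _ f) (P-step _) refl = there (Any.++⁺ˡ (⊨-¬ℛ p f))
  harmless-sound {i = i} (outsideP _ _ f _) (P-step _) refl = there (Any.++⁺ʳ (¬ℛ i) (here f))

isLast? : ∀ {n} (i : Fin n) → Dec (IsLast i)
isLast? {n} i = suc (toℕ i) ≟ n

maximum : ∀ {n} → Fin n → ∃ λ (j : Fin n) → IsLast j
maximum {suc n} _ = fromℕ n , cong suc (Fin.toℕ-fromℕ n)

-- Moving rows out of P ∩ R while respecting d literals

module Repair {d n : ℕ} (T : List (Literal (Var d n))) where
  open DecMembership (_≟ˡ_ {d} {n}) using (_∈?_)

  full? : ∀ i → Dec (∀ p → pos (R p i) ∈ T)
  full? i = Fin.all? λ p → pos (R p i) ∈? T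

  -- If T forces the row into R then it has no room for other literals of the row.
  repair′ : ∀ i → Dec (∀ p → pos (R p i) ∈ T) → Row d n i
  -- The only successor is the last index, whose row lies in R in every sound frame.
  repair′ i (yes _) = mkRow false (λ _ → true) λ j _ → does (isLast? j)
  -- By default P and R are false and S is true, so some `R p i` fails and, given room, some edge
  -- leaves `i`.
  repair′ i (no _)  = mkRow (does (pos (P i) ∈? T)) (λ p → does (pos (R p i) ∈? T))
                           λ j i<j → not (does (neg (S i j i<j) ∈? T))

  repair : ∀ i → Row d n i
  repair i = repair′ i (full? i)

  module _ (short : length T ≤ d) where

    -- The `d` literals `pos (R p i)` already fill `T`; `ℓ` would be one more.
    crowded : ∀ {i ℓ} → (∀ p → pos (R p i) ∈ T) → ℓ ∈ T → (∀ p → ℓ ≢ pos (R p i)) → ⊥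
    crowded {i} {ℓ} full ℓ∈T ℓ≢ = 1+n≰n (begin
      suc d                                            ≡⟨ cong suc (length-tabulate {n = d} _) ⟨
      length (ℓ ∷ tabulate λ p → pos (R p i))          ≤⟨ Unique-length-≤ unique ⊆T ⟩
      length T                                         ≤⟨ short ⟩
      d                                                ∎)
      where
      open ≤-Reasoning
      unique : AllPairs _≢_ (ℓ ∷ tabulate λ p → pos (R p i))
      unique = All.tabulate⁺ ℓ≢ ∷ AllPairs.tabulate⁺ λ where p≢q refl → p≢q refl
      ⊆T : ∀ {m} → m ∈ ℓ ∷ tabulate (λ p → pos (R p i)) → m ∈ T
      ⊆T (here refl) = ℓ∈T
      ⊆T (there m∈) with ∈-tabulate⁻ m∈
      ... | p , refl = full p

    -- By `crowded`, a full row carries only the literals `pos (R p i)` of `T`. In other rows the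
    -- values are read off from `T`, and `α` shows that `T` is consistent.
    repair′-⊨ : ∀ {α β : Valuation d n} i (full? : Dec (∀ p → pos (R p i) ∈ T)) → α ⊨∧ T →
      β i ≡ repair′ i full? → ∀ {ℓ} → ℓ ∈ T → literalRow ℓ ≡ i → β ⊨ ℓ
    repair′-⊨ i (yes full) α⊨T eq {pos (P _)} ℓ∈T refl = ⊥-elim (crowded full ℓ∈T λ _ ())
    repair′-⊨ i (yes full) α⊨T eq {neg (P _)} ℓ∈T refl = ⊥-elim (crowded full ℓ∈T λ _ ())
    repair′-⊨ i (yes full) α⊨T eq {pos (S _ _ _)} ℓ∈T refl = ⊥-elim (crowded full ℓ∈T λ _ ())
    repair′-⊨ i (yes full) α⊨T eq {neg (S _ _ _)} ℓ∈T refl = ⊥-elim (crowded full ℓ∈T λ _ ())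
    repair′-⊨ i (yes full) α⊨T eq {neg (R _ _)} ℓ∈T refl = ⊥-elim (crowded full ℓ∈T λ _ ())
    repair′-⊨ i (yes full) α⊨T eq {pos (R p _)} ℓ∈T refl = cong (λ r → inR r p) eq
    repair′-⊨ {α} i (no _) α⊨T eq {pos (P _)} ℓ∈T refl =
      trans (cong inP eq) (dec-true (_ ∈? T) ℓ∈T)
    repair′-⊨ {α} i (no _) α⊨T eq {neg (P _)} ℓ∈T refl =
      trans (cong inP eq) (dec-false (_ ∈? T) λ p∈T →
        consistent {α = α} (P i) (All.lookup α⊨T p∈T) (All.lookup α⊨T ℓ∈T))
    repair′-⊨ {α} i (no _) α⊨T eq {pos (R p _)} ℓ∈T refl =
      trans (cong (λ r → inR r p) eq) (dec-true (_ ∈? T) ℓ∈T)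
    repair′-⊨ {α} i (no _) α⊨T eq {neg (R p _)} ℓ∈T refl =
      trans (cong (λ r → inR r p) eq) (dec-false (_ ∈? T) λ p∈T →
        consistent {α = α} (R p i) (All.lookup α⊨T p∈T) (All.lookup α⊨T ℓ∈T))
    repair′-⊨ {α} i (no _) α⊨T eq {pos (S _ j i<j)} ℓ∈T refl =
      trans (cong (λ r → toS r j i<j) eq) (cong not (dec-false (_ ∈? T) λ n∈T →
        consistent {α = α} (S i j i<j) (All.lookup α⊨T ℓ∈T) (All.lookup α⊨T n∈T)))
    repair′-⊨ {α} i (no _) α⊨T eq {neg (S _ j i<j)} ℓ∈T refl =
      trans (cong (λ r → toS r j i<j) eq) (cong not (dec-true (_ ∈? T) ℓ∈T))

    -- The d + 1 variables S i j with j = i + 1, …, i + d + 1 cannot all be negated in T.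
    free-successor : ∀ i → suc (toℕ i) + d < n → ∃ λ j → ∃ λ (i<j : i Fin.< j) → neg (S i j i<j) ∉ T
    free-successor i room = case Fin.all? (λ k → neg (edge k) ∈? T) of λ where
        (yes all) → contradiction (begin
          suc d                          ≡⟨ length-tabulate (neg ∘ edge) ⟨
          length (tabulate (neg ∘ edge)) ≤⟨ Unique-length-≤ {ys = T} unique (⊆T all) ⟩
          length T                       ≤⟨ short ⟩
          d                              ∎) 1+n≰n
        (no ¬all) →
          let k , ∉T = Fin.¬∀⟶∃¬ _ _ (λ k → neg (edge k) ∈? T) ¬all
          in target k , i<target k , ∉T
      where
      open ≤-Reasoning
      inside : ∀ (k : Fin (suc d)) → suc (toℕ i) + toℕ k < n
      inside k = ≤-<-trans (+-monoʳ-≤ (suc (toℕ i)) (s≤s⁻¹ (Fin.toℕ<n k))) room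
      target : Fin (suc d) → Fin n
      target k = fromℕ< (inside k)
      i<target : ∀ k → i Fin.< target k
      i<target k = subst (toℕ i <_) (sym (Fin.toℕ-fromℕ< (inside k))) (m≤m+n _ _)
      edge : Fin (suc d) → Var d n
      edge k = S i (target k) (i<target k)
      edge-injective : ∀ {k l} → neg (edge k) ≡ neg (edge l) → k ≡ l
      edge-injective {k} {l} eq = Fin.toℕ-injective (+-cancelˡ-≡ (suc (toℕ i)) _ _
        (trans (sym (Fin.toℕ-fromℕ< (inside k)))
          (trans (cong (toℕ ∘ head) eq) (Fin.toℕ-fromℕ< (inside l)))))
        where
        head : Literal (Var d n) → Fin n
        head (neg (S _ j _)) = j
        head _               = i
      unique : Unique (tabulate (neg ∘ edge))
      unique = AllPairs.tabulate⁺ λ k≢l → k≢l ∘ edge-injective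
      ⊆T : (∀ k → neg (edge k) ∈ T) → ∀ {ℓ} → ℓ ∈ tabulate (neg ∘ edge) → ℓ ∈ T
      ⊆T all ℓ∈ with ∈-tabulate⁻ {f = neg ∘ edge} ℓ∈
      ... | k , refl = all k

    repair′-harmless : ∀ {β : Valuation d n} {i} (full? : Dec (∀ p → pos (R p i) ∈ T)) →
      suc (toℕ i) + d < n → (∀ {j} → IsLast j → ∀ p → inR (β j) p ≡ true) →
      β i ≡ repair′ i full? → Harmless β i
    repair′-harmless {β} {i} (yes _) room last⊆R eq = outsideP i<m
      (trans (cong (λ r → toS r m i<m) eq) (dec-true (isLast? m) m-last)) (cong inP eq) only-last
      where
      m = proj₁ (maximum i)
      m-last = proj₂ (maximum i)
      i<m : i Fin.< m
      i<m = s≤s⁻¹ (subst (suc (toℕ i) <_) (sym m-last) (≤-<-trans (m≤m+n _ d) room))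
      only-last : ∀ {j} (i<j : i Fin.< j) → toS (β i) j i<j ≡ true → ∀ p → inR (β j) p ≡ true
      only-last {j} i<j t = last⊆R (decidable-stable (isLast? j) λ j≢last →
        case trans (sym t)
          (trans (cong (λ r → toS r j i<j) eq) (dec-false (isLast? j) j≢last)) of λ ())
    repair′-harmless {β} {i} (no ¬full) room _ eq =
      let j , i<j , ∉T = free-successor i room
          p , p∉T      = Fin.¬∀⟶∃¬ _ _ (λ p → pos (R p i) ∈? T) ¬full
      in outsideR i<j
        (trans (cong (λ r → toS r j i<j) eq) (cong not (dec-false (_ ∈? T) ∉T)))
        (trans (cong (λ r → inR r p) eq) (dec-false (_ ∈? T) p∉T))

-- Chains and states

-- `diverge` wants more steps than twice the number of marked rows, of which there are at most `d`.
steps : ℕ → ℕ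
steps d = suc (2 * d)

module _ {n : ℕ} where

  end : Fin n → List (Fin n) → Fin n
  end u []       = u
  end u (v ∷ vs) = end v vs

  end-∈ : ∀ {u} vs → end u vs ∈ u ∷ vs
  end-∈ []       = here refl
  end-∈ (v ∷ vs) = there (end-∈ vs)

  end-⊆ : ∀ {u} vs {ws} → end u vs ∷ ws ⊆ u ∷ vs ++ ws
  end-⊆ []       = ⊆-refl
  end-⊆ (v ∷ vs) = _ ∷ʳ end-⊆ vs

module _ {d n : ℕ} where

  Chain : Valuation d n → Fin n → List (Fin n) → Set
  Chain α u []       = OnPath (α u)
  Chain α u (v ∷ vs) = α u ≡ link v × Chain α v vs

  Chain-onPath : ∀ {α : Valuation d n} {u} vs → Chain α u vs → OnPath (α u)
  Chain-onPath []      on       = on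
  Chain-onPath (_ ∷ _) (eq , _) = subst OnPath (sym eq) (refl , λ _ → refl)

  Chain-cong : ∀ {α β : Valuation d n} {u} vs →
    (∀ {i} → i ∈ u ∷ vs → α i ≡ β i) → Chain β u vs → Chain α u vs
  Chain-cong []       α≡β on       = subst OnPath (sym (α≡β (here refl))) on
  Chain-cong (v ∷ vs) α≡β (eq , c) = trans (α≡β (here refl)) eq , Chain-cong vs (α≡β ∘ there) c

  -- As the list increases, every chain row before the end avoids `end u vs ∷ ws`, so its link is
  -- the same in both valuations; the end itself only has to be in P ∩ R.
  Chain-transfer : ∀ {α β : Valuation d n} {u ws} vs → AllPairs Fin._<_ (u ∷ vs ++ ws) →
    (∀ {i} → i ∈ u ∷ vs → i ∉ end u vs ∷ ws → α i ≡ β i) →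
    OnPath (α (end u vs)) → Chain β u vs → Chain α u vs
  Chain-transfer []       _            _   on _        = on
  Chain-transfer (v ∷ vs) (u< ∷ sorted) α≡β on (eq , c) =
    trans (α≡β (here refl) λ u∈ →
      Fin.<-irrefl refl (All.lookup u< (Sublist.lookup (end-⊆ vs) u∈))) eq ,
    Chain-transfer vs sorted (α≡β ∘ there) on c

  Chain-linked : ∀ {α : Valuation d n} {u i} vs → AllPairs Fin._<_ (u ∷ vs) → Chain α u vs →
    i ∈ u ∷ vs → i ≢ end u vs → Harmless α i
  Chain-linked []       _            _        (here refl) i≢ = contradiction refl i≢
  Chain-linked (v ∷ vs) (u< ∷ _)     (eq , c) (here refl) _  =
    linked (All.head u<) eq (Chain-onPath vs c)
  Chain-linked (v ∷ vs) (_ ∷ sorted) (_ , c)  (there i∈)  i≢ =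
    Chain-linked vs sorted c i∈ i≢

  override : Valuation d n → Fin n → Fin n → Valuation d n
  override γ u v i = if does (i Fin.≟ u) then link v else γ i

  -- γ with a chain through u ∷ vs; only P and R of its last row will matter.
  trace : Valuation d n → Fin n → List (Fin n) → Valuation d n
  trace γ u []       = override γ u u
  trace γ u (v ∷ vs) = override (trace γ v vs) u v

  override-≢ : ∀ (γ : Valuation d n) {u v i} → i ≢ u → override γ u v i ≡ γ i
  override-≢ γ {u} {v} {i} i≢u = cong (if_then link v else γ i) (dec-false (i Fin.≟ u) i≢u)

  override-≡ : ∀ (γ : Valuation d n) {u v} → override γ u v u ≡ link v
  override-≡ γ {u} {v} = cong (if_then link v else γ u) (dec-true (u Fin.≟ u) refl)

  trace-∉ : ∀ (γ : Valuation d n) {u i} vs → i ∉ u ∷ vs → trace γ u vs i ≡ γ i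
  trace-∉ γ []       i∉ = override-≢ γ (i∉ ∘ here)
  trace-∉ γ (v ∷ vs) i∉ = trans (override-≢ (trace γ v vs) (i∉ ∘ here)) (trace-∉ γ vs (i∉ ∘ there))

  trace-Chain : ∀ (γ : Valuation d n) {u} vs → AllPairs Fin._<_ (u ∷ vs) → Chain (trace γ u vs) u vs
  trace-Chain γ {u} [] _ = subst OnPath (sym (override-≡ γ {u} {u})) (refl , λ _ → refl)
  trace-Chain γ (v ∷ vs) (u< ∷ sorted) =
    override-≡ (trace γ v vs) ,
    Chain-cong vs (λ i∈ → override-≢ (trace γ v vs) (Fin.<⇒≢ (All.lookup u< i∈) ∘ sym))
      (trace-Chain γ vs sorted)

  module _ {Marked : Fin n → Set} (marked? : Decidable Marked) where

    end-unmarked : ∀ {u ys ys′} → Diverges marked? u ys ys′ → ¬ Marked (end u ys′)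
    end-unmarked (follow e)              = end-unmarked e
    end-unmarked (depart {ys′ = ys′} u∉ us) = All.lookup (u∉ ∷ us) (end-∈ ys′)

    -- Before the departure the traced links are those of `α`; from there on nothing is marked.
    trace-marked : ∀ {α γ : Valuation d n} {u ys ys′ i} → Diverges marked? u ys ys′ →
      Chain α u ys → Marked i → i ∈ u ∷ ys′ → trace γ u ys′ i ≡ α i
    trace-marked (depart u∉ us) _ m i∈ = contradiction m (All.lookup (u∉ ∷ us) i∈)
    trace-marked {u = u} {i = i} (follow e) (eq , c) m i∈ with i Fin.≟ u | i∈
    ... | yes refl | _          = sym eq
    ... | no  i≢u  | here i≡u   = contradiction i≡u i≢u
    ... | no  _    | there i∈ys = trace-marked e c m i∈ys

  record Frame : Set where
    constructor ⟨_,_,_⟩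
    field
      source : Fin n
      live   : List (Fin n)
      fixed  : Valuation d n

    undetermined : List (Fin n)
    undetermined = source ∷ live
  open Frame

  -- `α` is free on the live rows off `path` and on the `S` variables of its last row.
  record _∈ᶠ_ (α : Valuation d n) (F : Frame) : Set where
    field
      outside : ∀ {i} → i ∉ undetermined F → α i ≡ fixed F i
      {path rest} : List (Fin n)
      ballot  : Ballot 0 (steps d) (live F) path rest
      chain   : Chain α (source F) path
  open _∈ᶠ_

  Sorted : Frame → Set
  Sorted F = AllPairs Fin._<_ (undetermined F)

  Roomy : Frame → Set
  Roomy F = All (λ i → suc (toℕ i) + d < n) (live F)

  Sound : Frame → Set
  Sound F = ∀ {α C} → α ∈ᶠ F → (a : RIP d n C) →
    (∀ {i} → Source a i → i ∉ undetermined F) → α ⊨∨ C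

  inhabited : ∀ F → Sorted F → steps d ≤ length (live F) → ∃ (_∈ᶠ F)
  inhabited F sorted enough = trace (fixed F) (source F) prefix , record
    { outside = λ i∉ → trace-∉ (fixed F) prefix λ where
        (here i≡)  → i∉ (here i≡)
        (there i∈) → i∉ (there (Sublist.lookup (Sublist.take-⊆ (steps d) _) i∈))
    ; ballot  = prefix-Ballot (steps d) enough
    ; chain   = trace-Chain (fixed F) prefix
        (AllPairs-resp-⊆ (refl ∷ Sublist.take-⊆ (steps d) _) sorted)
    }
    where prefix = List.take (steps d) (live F)

  open DecMembership (Fin._≟_ {n}) using () renaming (_∈?_ to _∈?ᶠ_)

  -- Forcing the literals of `T` on a smaller frame

  module Extend (F : Frame) (sorted : Sorted F) (roomy : Roomy F) (sound : Sound F)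
    (long : 2 * steps d + d ≤ length (live F)) {α} (α∈F : α ∈ᶠ F)
    (T : List (Literal (Var d n))) (short : length T ≤ d) (α⊨T : α ⊨∧ T) where

    open Repair T

    Marked : Fin n → Set
    Marked i = i ∈ map literalRow T

    marked? : Decidable Marked
    marked? i = i ∈?ᶠ map literalRow T

    marks≤d : ∀ {L} → AllPairs Fin._<_ L → marks marked? L ≤ d
    marks≤d {L} L< = begin
      marks marked? L           ≤⟨ Unique-length-≤ unique (proj₂ ∘ ∈-filter⁻ marked? {xs = L}) ⟩
      length (map literalRow T) ≡⟨ length-map literalRow T ⟩
      length T                  ≤⟨ short ⟩
      d                         ∎
      where
      open ≤-Reasoning
      unique : Unique (filter marked? L)
      unique = AllPairs.filter⁺ marked? (AllPairs.map Fin.<⇒≢ L<)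

    diverged : ∃₂ λ ys M →
      Ballot 0 (steps d) (live F) ys M × Diverges marked? (source F) (path α∈F) ys
    diverged = diverge marked? (source F) (ballot α∈F)
      (s≤s (≤-trans (*-monoʳ-≤ 2 (marks≤d (AllPairs.tail sorted))) (m≤m+n (2 * d) _)))
      (≤-trans (+-monoʳ-≤ (2 * steps d) (marks≤d (AllPairs.tail sorted))) long)

    newPath newRest newLive : List (Fin n)
    newPath = proj₁ diverged
    newRest = proj₁ (proj₂ diverged)
    newLive = filter (¬? ∘ marked?) newRest

    newBallot : Ballot 0 (steps d) (live F) newPath newRest
    newBallot = proj₁ (proj₂ (proj₂ diverged))

    divergence : Diverges marked? (source F) (path α∈F) newPath
    divergence = proj₂ (proj₂ (proj₂ diverged))

    newSource : Fin n
    newSource = end (source F) newPath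

    background : Valuation d n
    background i = if does (i ∈?ᶠ live F) then repair i else fixed F i

    F′ : Frame
    F′ = ⟨ newSource , newLive , trace background (source F) newPath ⟩

    split-⊆ : newPath ++ newLive ⊆ live F
    split-⊆ = ⊆-trans (Sublist.++⁺ ⊆-refl (Sublist.filter-⊆ _ newRest)) (Ballot-⊆ newBallot)

    path-⊆ : newPath ⊆ live F
    path-⊆ = ⊆-trans (Sublist.++⁺ʳ newLive ⊆-refl) split-⊆

    sorted-split : AllPairs Fin._<_ (source F ∷ newPath ++ newLive)
    sorted-split = AllPairs-resp-⊆ (refl ∷ split-⊆) sorted

    sorted-path : AllPairs Fin._<_ (source F ∷ newPath)
    sorted-path = AllPairs-resp-⊆ (refl ∷ Sublist.++⁺ʳ newLive ⊆-refl) sorted-split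

    sorted′ : Sorted F′
    sorted′ = AllPairs-resp-⊆ (end-⊆ newPath) sorted-split

    undetermined-⊆ : undetermined F′ ⊆ undetermined F
    undetermined-⊆ = ⊆-trans (end-⊆ newPath) (refl ∷ split-⊆)

    roomy′ : Roomy F′
    roomy′ = Sublist.All-resp-⊆ (⊆-trans (Sublist.++⁺ˡ newPath ⊆-refl) split-⊆) roomy

    unmarked′ : ∀ {i} → i ∈ undetermined F′ → ¬ Marked i
    unmarked′ (here refl) = end-unmarked marked? divergence
    unmarked′ (there i∈)  = proj₂ (∈-filter⁻ (¬? ∘ marked?) {xs = newRest} i∈)

    long′ : length (live F) ≤ 2 * steps d + d + length newLive
    long′ = begin
      length (live F)
        ≤⟨ Ballot-length newBallot ⟩
      2 * steps d + length newRest
        ≡⟨ cong (2 * steps d +_) (length-filter-¬ marked? newRest) ⟩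
      2 * steps d + (marks marked? newRest + length newLive)
        ≤⟨ +-monoʳ-≤ (2 * steps d) (+-monoˡ-≤ _ (marks≤d rest-sorted)) ⟩
      2 * steps d + (d + length newLive)
        ≡⟨ +-assoc (2 * steps d) d _ ⟨
      2 * steps d + d + length newLive
        ∎
      where
      open ≤-Reasoning
      rest-sorted : AllPairs Fin._<_ newRest
      rest-sorted = AllPairs-resp-⊆ (⊆-trans (Sublist.++⁺ˡ newPath ⊆-refl) (Ballot-⊆ newBallot))
        (AllPairs.tail sorted)

    background-∉ : ∀ {i} → i ∉ live F → background i ≡ fixed F i
    background-∉ {i} i∉ = cong (if_then repair i else fixed F i) (dec-false (i ∈?ᶠ live F) i∉)

    background-∈ : ∀ {i} → i ∈ live F → background i ≡ repair i
    background-∈ {i} i∈ = cong (if_then repair i else fixed F i) (dec-true (i ∈?ᶠ live F) i∈)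

    -- `newPath` is the path that `F` demands: its links are fixed in `F′`, and its end is in P ∩ R
    -- because the chain of `β` in `F′` starts there.
    narrower : ∀ {β} → β ∈ᶠ F′ → β ∈ᶠ F
    narrower {β} β∈ = record
      { outside = λ {i} i∉ → trans (outside β∈ (i∉ ∘ Sublist.lookup undetermined-⊆))
          (trans (trace-∉ background newPath (i∉ ∘ Sublist.lookup (refl ∷ path-⊆)))
            (background-∉ (i∉ ∘ there)))
      ; ballot  = newBallot
      ; chain   = Chain-transfer newPath sorted-split (λ _ → outside β∈)
          (Chain-onPath (path β∈) (chain β∈)) (trace-Chain background newPath sorted-path)
      }

    off-path : ∀ {β i} → β ∈ᶠ F′ →
      i ∉ undetermined F′ → i ∉ source F ∷ newPath → i ∈ live F → β i ≡ repair i
    off-path β∈ i∉ i∉path i∈ =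
      trans (outside β∈ i∉) (trans (trace-∉ background newPath i∉path) (background-∈ i∈))

    -- A row that becomes determined is either linked, on the new chain before its end, or repaired.
    -- Axioms with no source among the undetermined rows of `F` are inherited.
    sound′ : Sound F′
    sound′ {β} β∈ a avoids = case Fin.any? (λ i → source? a i ×-dec i ∈?ᶠ undetermined F) of λ where
        (yes (i , src , i∈)) → harmless-sound (harmless i∈ (avoids src)) a src
        (no none)            → sound (narrower β∈) a λ src i∈ → none (_ , src , i∈)
      where
      harmless : ∀ {i} → i ∈ undetermined F → i ∉ undetermined F′ → Harmless β i
      harmless {i} i∈ i∉ with i ∈?ᶠ (source F ∷ newPath)
      ... | yes i∈path = Chain-linked newPath sorted-path (chain (narrower β∈)) i∈path (i∉ ∘ here)
      ... | no i∉path with i∈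
      ...   | here refl = contradiction (here refl) i∉path
      ...   | there i∈L = repair′-harmless short (full? i) (All.lookup roomy i∈L)
                -- `R-last` has no source, so it holds in every valuation of `F`.
                (λ last p → case sound (narrower β∈) (R-last p last) (λ ()) of λ where (here t) → t)
                (off-path β∈ i∉ i∉path i∈L)

    -- No marked row is undetermined in `F′`: on the new chain it is as in `α`, elsewhere among the
    -- live rows it is repaired, and outside `F` it was fixed before.
    forced : ∀ {β} → β ∈ᶠ F′ → β ⊨∧ T
    forced {β} β∈ = All.tabulate λ {ℓ} ℓ∈T → true-in ℓ∈T (∈-map⁺ literalRow ℓ∈T)
      where
      true-in : ∀ {ℓ} → ℓ ∈ T → Marked (literalRow ℓ) → β ⊨ ℓ
      true-in {ℓ} ℓ∈T m with literalRow ℓ ∈?ᶠ (source F ∷ newPath) | literalRow ℓ ∈?ᶠ live F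
      ... | yes i∈path | _ = ⊨-cong ℓ (sym (trans (outside β∈ λ i∈ → unmarked′ i∈ m)
              (trace-marked marked? divergence (chain α∈F) m i∈path))) (All.lookup α⊨T ℓ∈T)
      ... | no i∉path | yes i∈L = repair′-⊨ short _ (full? _) α⊨T
              (off-path β∈ (λ i∈ → unmarked′ i∈ m) i∉path i∈L) ℓ∈T refl
      ... | no i∉path | no i∉L = ⊨-cong ℓ
              (trans (outside α∈F i∉F) (sym (outside (narrower β∈) i∉F))) (All.lookup α⊨T ℓ∈T)
        where
        i∉F : literalRow ℓ ∉ undetermined F
        i∉F (here i≡)  = i∉path (here i≡)
        i∉F (there i∈) = i∉L i∈

-- Forcing literals uses up at most 2 (2d + 1) + d live indices; 2d + 1 have to
-- remain for a state to be inhabited.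
coin : ∀ d .{{_ : NonZero d}} → 2 * steps d + d + steps d ≤ 10 * d
coin (suc e) = subst (lhs ≤_) (eq e) (m≤m+n lhs (3 * e))
  where
  lhs = 2 * steps (suc e) + suc e + steps (suc e)
  eq : ∀ e → 2 * suc (2 * suc e) + suc e + suc (2 * suc e) + 3 * e ≡ 10 * suc e
  eq = solve-∀

-- The Delayer strategy

module _ {d n : ℕ} .{{_ : NonZero d}} where
  open Frame
  open _∈ᶠ_

  record State (k : ℕ) : Set where
    field
      frame  : Frame {d} {n}
      sorted : Sorted frame
      roomy  : Roomy frame
      sound  : Sound frame
      large  : 10 * d * k ≤ length (live frame)
  open State

  coin≤ : ∀ {k} (σ : State (suc k)) → 10 * d ≤ length (live (frame σ))
  coin≤ {k} σ = ≤-trans (m≤m*n (10 * d) (suc k)) (large σ)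

  long : ∀ {k} (σ : State (suc k)) → 2 * steps d + d ≤ length (live (frame σ))
  long σ = ≤-trans (m+n≤o⇒m≤o (2 * steps d + d) (coin d)) (coin≤ σ)

  force : ∀ {k α} (σ : State (suc k)) → α ∈ᶠ frame σ → ∀ T → length T ≤ d → α ⊨∧ T →
    ∃ λ (τ : State k) → ∀ {β} → β ∈ᶠ frame τ → β ∈ᶠ frame σ × β ⊨∧ T
  force {k} σ α∈ T short α⊨T = record
    { frame = F′ ; sorted = sorted′ ; roomy = roomy′ ; sound = sound′ ; large = large′ } ,
    λ β∈ → narrower β∈ , forced β∈
    where
    open Extend (frame σ) (sorted σ) (roomy σ) (sound σ) (long σ) α∈ T short α⊨T
    large′ : 10 * d * k ≤ length newLive
    large′ = +-cancelˡ-≤ (10 * d) _ _ (begin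
      10 * d + 10 * d * k              ≡⟨ *-suc (10 * d) k ⟨
      10 * d * suc k                   ≤⟨ large σ ⟩
      length (live (frame σ))          ≤⟨ long′ ⟩
      2 * steps d + d + length newLive ≤⟨ +-monoˡ-≤ _ (m+n≤o⇒m≤o (2 * steps d + d) (coin d)) ⟩
      10 * d + length newLive          ∎)
      where open ≤-Reasoning

  -- Forcing a literal of row i moves i off the undetermined rows.
  row-determined : ∀ {k α} (σ : State (suc k)) → α ∈ᶠ frame σ → ∀ {ℓ} → α ⊨ ℓ →
    ∀ {C} (a : RIP d n C) → Source a (literalRow ℓ) →
    ∃ λ β → β ∈ᶠ frame σ × β ⊨∨ C
  row-determined {k} σ α∈ {ℓ} t a src =
    let β , β∈ = inhabited F′ sorted′ enough
    in β , narrower β∈ , sound′ β∈ a λ src′ i∈ →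
      unmarked′ i∈ (here (Source-unique a src′ src))
    where
    open Extend (frame σ) (sorted σ) (roomy σ) (sound σ) (long σ) α∈ [ ℓ ] (>-nonZero⁻¹ d) (t ∷ [])
    enough : steps d ≤ length newLive
    enough = +-cancelˡ-≤ (2 * steps d + d) _ _ (≤-trans (coin d) (≤-trans (coin≤ σ) long′))

  -- An axiom without source holds by soundness. For source `i`, forcing the value that `P i` takes
  -- in some valuation determines row `i`, and the smaller frame still has a valuation, which
  -- satisfies the axiom.
  unrefuted : ∀ {k C} (σ : State (suc k)) → RIP d n C → ¬ (∀ {α} → α ∈ᶠ frame σ → ¬ α ⊨∨ C)
  unrefuted {C = C} σ a refuted
    with inhabited (frame σ) (sorted σ) (≤-trans (m+n≤o⇒n≤o (2 * steps d + d) (coin d)) (coin≤ σ))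
  ... | α , α∈ with Fin.any? (source? a)
  ...   | no none = refuted α∈ (sound σ α∈ a λ src _ → none (_ , src))
  ...   | yes (i , src) = case α ⊨? pos (P i) of λ where
      (yes t) → contradicted (row-determined σ α∈ {pos (P i)} t a src)
      (no f)  → contradicted
        (row-determined σ α∈ {neg (P i)} (∁-complete {α = α} (pos (P i)) f) a src)
    where
    contradicted : ¬ (∃ λ β → β ∈ᶠ frame σ × β ⊨∨ C)
    contradicted (_ , β∈ , β⊨C) = refuted β∈ β⊨C

  strategy : Strategy {Ax = RIP d n} (value {d} {n})
  strategy = record
    { State = State ; _∈ˢ_ = λ α σ → α ∈ᶠ frame σ ; unrefuted = unrefuted ; force = force }

-- The initial state

module Initial {d n m : ℕ} .{{_ : NonZero d}} (fits : suc m + d < suc n) where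
  open Frame
  open _∈ᶠ_

  m≤n : m ≤ n
  m≤n = ≤-trans (m≤m+n m d) (≤-trans (n≤1+n _) (s≤s⁻¹ fits))

  first : Fin m → Fin (suc n)
  first k = Fin.suc (Fin.inject≤ k m≤n)

  -- A row outside R with edges to all later indices is harmless. The last row is in R for `R-last`
  -- and outside P for `P-last`.
  default : ∀ i → Row d (suc n) i
  default i = mkRow false (λ _ → does (isLast? i)) λ _ _ → true

  F₀ : Frame {d} {suc n}
  F₀ = ⟨ Fin.zero , tabulate first , default ⟩

  toℕ-first : ∀ k → toℕ (first k) ≡ suc (toℕ k)
  toℕ-first k = cong suc (Fin.toℕ-inject≤ k m≤n)

  sorted₀ : Sorted F₀
  sorted₀ = All.tabulate⁺ {n = m} (λ _ → s≤s z≤n) ∷ AllPairs.tabulate⁺-< λ {k} {l} k<l →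
    subst₂ _<_ (sym (toℕ-first k)) (sym (toℕ-first l)) (s≤s k<l)

  roomy₀ : Roomy F₀
  roomy₀ = All.tabulate⁺ λ k → ≤-<-trans
    (+-monoˡ-≤ d (s≤s (≤-trans (≤-reflexive (toℕ-first k)) (Fin.toℕ<n k)))) fits

  last-determined : ∀ {i} → IsLast i → i ∉ undetermined F₀
  last-determined last (here refl) = <⇒≢ (≤-<-trans (s≤s z≤n) fits) last
  last-determined last (there i∈)  =
    <⇒≢ (≤-<-trans (m≤m+n _ d) (All.lookup roomy₀ i∈)) last

  default-harmless : ∀ {α : Valuation d (suc n)} {i j} → Fin d →
    α i ≡ default i → i Fin.< j → Harmless α i
  default-harmless {i = i} {j} p eq i<j = outsideR {p = p} i<j (cong (λ r → Row.toS r j i<j) eq)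
    (trans (cong (λ r → Row.inR r p) eq) (dec-false (isLast? i)
      (<⇒≢ (≤-trans (s≤s i<j) (Fin.toℕ<n j)))))

  someFin : ∀ d .{{_ : NonZero d}} → Fin d
  someFin (suc _) = Fin.zero

  sound₀ : Sound F₀
  sound₀ α∈ (P-first {Fin.zero} _) _ = here (proj₁ (Chain-onPath (path α∈) (chain α∈)))
  sound₀ α∈ (R-first {Fin.zero} p _) _ = here (proj₂ (Chain-onPath (path α∈) (chain α∈)) p)
  sound₀ α∈ (P-last last) _ = here (cong Row.inP (outside α∈ (last-determined last)))
  sound₀ α∈ (R-last {i} p last) _ =
    here (trans (cong (λ r → Row.inR r p) (outside α∈ (last-determined last)))
      (dec-true (isLast? i) last))
  sound₀ α∈ a@(S-some i i<) avoids =
    harmless-sound (default-harmless (someFin d) (outside α∈ (avoids refl)) i<max) a refl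
    where
    i<max : i Fin.< proj₁ (maximum i)
    i<max = s≤s⁻¹ (subst (suc (toℕ i) <_) (sym (proj₂ (maximum i))) i<)
  sound₀ α∈ a@(R-step i<j p) avoids =
    harmless-sound (default-harmless (someFin d) (outside α∈ (avoids refl)) i<j) a refl
  sound₀ α∈ a@(P-step i<j) avoids =
    harmless-sound (default-harmless (someFin d) (outside α∈ (avoids refl)) i<j) a refl

-- Refutations have size at least two

module _ {d n : ℕ} (n≥2 : 2 ≤ n) where

  first? : ∀ (i : Fin n) → Dec (IsFirst i)
  first? i = toℕ i ≟ 0

  -- Each of these valuations falsifies a single clause: P₁, ¬Pₙ and ⋁ⱼ S₁ⱼ.
  critical : Fin 3 → Valuation d n
  critical Fin.zero                       i = mkRow false (λ _ → true) λ _ _ → true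
  critical (Fin.suc Fin.zero)             i = mkRow true (λ _ → true) λ _ _ → true
  critical (Fin.suc (Fin.suc Fin.zero))   i = mkRow (does (first? i)) (λ _ → true)
    λ _ _ → not (does (first? i))

  blame : ∀ {C} → RIP d n C → Fin 3
  blame (P-first _) = Fin.zero
  blame (P-last _)  = Fin.suc Fin.zero
  -- Meant for `S-some`; the remaining axioms are falsified by no critical valuation and get it as a
  -- default.
  blame _           = Fin.suc (Fin.suc Fin.zero)

  critical-separated : ∀ {C} (a : RIP d n C) {s} → ¬ critical s ⊨∨ C → s ≡ blame a
  critical-separated (P-first _) {Fin.zero} _ = refl
  critical-separated (P-first _) {Fin.suc Fin.zero} h = contradiction (here refl) h
  critical-separated (P-first {i} z) {Fin.suc (Fin.suc Fin.zero)} h =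
    contradiction (here (dec-true (first? i) z)) h
  critical-separated (P-last _) {Fin.zero} h = contradiction (here refl) h
  critical-separated (P-last _) {Fin.suc Fin.zero} h = refl
  critical-separated (P-last {i} last) {Fin.suc (Fin.suc Fin.zero)} h =
    contradiction (here (dec-false (first? i) λ z → <⇒≢ n≥2 (trans (cong suc (sym z)) last))) h
  critical-separated (R-first p _) {Fin.zero} h = contradiction (here refl) h
  critical-separated (R-first p _) {Fin.suc Fin.zero} h = contradiction (here refl) h
  critical-separated (R-first p _) {Fin.suc (Fin.suc Fin.zero)} h = refl
  critical-separated (R-last p _) {Fin.zero} h = contradiction (here refl) h
  critical-separated (R-last p _) {Fin.suc Fin.zero} h = contradiction (here refl) h
  critical-separated (R-last p _) {Fin.suc (Fin.suc Fin.zero)} h = refl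
  critical-separated (S-some i i<) {s} h with maximum i
  ... | j , last = go s h
    where
    i<j : i Fin.< j
    i<j = s≤s⁻¹ (subst (suc (toℕ i) <_) (sym last) i<)
    go : ∀ s → ¬ critical s ⊨∨ successors i → s ≡ Fin.suc (Fin.suc Fin.zero)
    go Fin.zero                     h = contradiction (⊨-successors i<j refl) h
    go (Fin.suc Fin.zero)           h = contradiction (⊨-successors i<j refl) h
    go (Fin.suc (Fin.suc Fin.zero)) h = refl
  critical-separated (R-step {i} i<j p) {s} h =
    contradiction (there (Any.++⁺ʳ (¬ℛ i) (here (all-R s)))) h
    where
    all-R : ∀ s {j} → Row.inR (critical s j) p ≡ true
    all-R Fin.zero                     = refl
    all-R (Fin.suc Fin.zero)           = refl
    all-R (Fin.suc (Fin.suc Fin.zero)) = refl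
  critical-separated (P-step {i} i<j) {Fin.zero} h =
    contradiction (there (Any.++⁺ʳ (¬ℛ i) (here refl))) h
  critical-separated (P-step {i} i<j) {Fin.suc Fin.zero} h =
    contradiction (there (Any.++⁺ʳ (¬ℛ i) (there (here refl)))) h
  critical-separated (P-step {i} i<j) {Fin.suc (Fin.suc Fin.zero)} h = refl

  -- Three different leaves are needed, and there are at most `suc (size π)`. This settles n < 100
  -- d, where `many-coins` does not play the strategy.
  size≥2 : .{{_ : NonZero d}} (π : Refutation d (RIP d n)) → 2 ≤ size π
  size≥2 π = s≤s⁻¹ (leaves-≥ value critical
    (λ a ¬s ¬t → trans (critical-separated a ¬s) (sym (critical-separated a ¬t))) π)

-- The final calculation with rational exponents

open import Data.Integer.Base using (+_)

-- For `q = a / b` the hypothesis says `a ≤ K * b`, and `2 ^ K ≤ s` is raised to the power `b`. For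
-- negative `q` it suffices that `s` is positive.
2^-mono : ∀ {q s} K → ℚ.toℚᵘ q ℚᵘ.≤ mkℚᵘ (+ K) 0 → 2 ^ K ≤ s → 2^ q ≤ s
2^-mono {ℚ.mkℚ (+ a) b _} {s} K (*≤* a≤) 2^K≤s = begin
  2 ^ a             ≤⟨ ^-monoʳ-≤ 2 (ℤ.drop‿+≤+ exponents) ⟩
  2 ^ (K * suc b)   ≡⟨ ^-*-assoc 2 K (suc b) ⟨
  (2 ^ K) ^ suc b   ≤⟨ ^-monoˡ-≤ (suc b) 2^K≤s ⟩
  s ^ suc b         ∎
  where
  open ≤-Reasoning
  exponents : + a ℤ.≤ + (K * suc b)
  exponents = subst₂ ℤ._≤_ (ℤ.*-identityʳ (+ a)) (sym (ℤ.pos-* K (suc b))) a≤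
2^-mono {ℚ.mkℚ ℤ.-[1+ a ] b _} {s} K _ 2^K≤s =
  *-mono-≤ (m^n>0 2 (suc a)) (m^n>0 s {{>-nonZero (≤-trans (m^n>0 2 K) 2^K≤s)}} (suc b))

-- For K ≥ 1, K + 2 coins of 10 d indices and d + 2 further indices fit into 100 d K.
rate : ℚ
rate = + 1 ℚ./ 100

exponent-bound : ∀ n d .{{_ : NonZero d}} K → n ≤ K * (100 * d) →
  ℚ.toℚᵘ (rate ℚ.* (+ n ℚ./ d)) ℚᵘ.≤ mkℚᵘ (+ K) 0
exponent-bound n (suc e) K n≤ = begin
  ℚ.toℚᵘ (rate ℚ.* (+ n ℚ./ suc e))         ≃⟨ ℚ.toℚᵘ-homo-* rate (+ n ℚ./ suc e) ⟩
  mkℚᵘ (+ 1) 99 ℚᵘ.* ℚ.toℚᵘ (+ n ℚ./ suc e) ≃⟨ ℚᵘ.*-congˡ {mkℚᵘ (+ 1) 99} (ℚ.toℚᵘ-fromℚᵘ _) ⟩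
  mkℚᵘ (+ 1) 99 ℚᵘ.* mkℚᵘ (+ n) e           ≤⟨ *≤* cross ⟩
  mkℚᵘ (+ K) 0                              ∎
  where
  open ℚᵘ.≤-Reasoning
  cross : (+ 1 ℤ.* + n) ℤ.* + 1 ℤ.≤ + K ℤ.* + (100 * suc e)
  cross = subst₂ ℤ._≤_ (sym (trans (ℤ.*-identityʳ _) (ℤ.*-identityˡ _)))
    (ℤ.pos-* K (100 * suc e)) (ℤ.+≤+ n≤)

-- `K` will be n / (100 d) rounded down; the exponent `suc K` makes up for the rounding.
many-coins : ∀ n d .{{_ : NonZero d}} K → 2 ≤ n → K * (100 * d) ≤ n →
  (π : Refutation d (RIP d n)) → 2 ^ suc K ≤ size π
many-coins n d zero n≥2 _ π = size≥2 n≥2 π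
many-coins zero d (suc K) () _ π
many-coins (suc n) d (suc K) _ K≤ π = s≤s⁻¹ (begin
  -- One coin more than the exponent absorbs the 1 in `suc (size π)`.
  suc (2 ^ suc (suc K))                ≤⟨ +-monoˡ-≤ _ (m^n>0 2 (suc (suc K))) ⟩
  2 ^ suc (suc K) + 2 ^ suc (suc K)    ≡⟨ cong (_+_ (2 ^ suc (suc K))) (+-identityʳ _) ⟨
  2 ^ suc (suc (suc K))                ≤⟨ size-lower-bound value strategy π σ₀ (λ _ ()) ⟩
  suc (size π)                         ∎)
  where
  open ≤-Reasoning
  m = 10 * d * suc (suc (suc K))
  eq : ∀ e K → suc (suc (10 * suc e * suc (suc (suc K)) + suc e)) + (90 * K * suc e + 67 + 69 * e)
    ≡ suc K * (100 * suc e)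
  eq = solve-∀
  fits′ : ∀ d .{{_ : NonZero d}} → suc (suc (10 * d * suc (suc (suc K)) + d)) ≤ suc K * (100 * d)
  fits′ (suc e) = subst (lhs ≤_) (eq e K) (m≤m+n lhs _)
    where lhs = suc (suc (10 * suc e * suc (suc (suc K)) + suc e))
  open Initial {d} {n} {m} (≤-trans (fits′ d) K≤)
  σ₀ : State {d} {suc n} (suc (suc (suc K)))
  σ₀ = record { frame = F₀ ; sorted = sorted₀ ; roomy = roomy₀ ; sound = sound₀
              ; large = ≤-reflexive (sym (length-tabulate first)) }

proposition6 : ∃[ c ] ∃[ n₀ ] 0ℚ ℚ.< c ×
    (∀ (n : ℕ) → n₀ ≤ n → ∀ (d : ℕ) .{{_ : NonZero d}} → d ≤ n →
    (π : Refutation d (RIP d n)) → 2^ (c ℚ.* (+ n ℚ./ d)) ≤ size π)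
-- For n = 1 a single cut of `P-first` against `P-last` is a refutation, and its size 1 is below
-- every positive power of 2; hence 2 for `n₀`.
proposition6 = rate , 2 , from-yes (0ℚ ℚ.<? rate) , λ n n≥2 d _ π → bounded n n≥2 d π
  where
  bounded : ∀ n → 2 ≤ n → ∀ d .{{_ : NonZero d}} (π : Refutation d (RIP d n)) →
    2^ (rate ℚ.* (+ n ℚ./ d)) ≤ size π
  bounded n n≥2 d@(suc e) π = 2^-mono (suc K) (exponent-bound n d (suc K) below)
    (many-coins n d K n≥2 (m/n*n≤m n (100 * d)) π)
    where
    K = n / (100 * d)
    below : n ≤ suc K * (100 * d)
    below = ≤-trans (≤-reflexive (m≡m%n+[m/n]*n n (100 * d)))
      (+-monoˡ-≤ (K * (100 * d)) (<⇒≤ (m%n<n n (100 * d))))
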